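{- For every $\varepsilon>0$ there are infinitely many positive integers $n$ for which there exist connected nonisomorphic graphs $G,H$ on $n$ vertices with the same degree sequence and $b(G,H)>(1-\varepsilon)n$. Equivalently, $$\limsup_{n\to\infty}\frac{B(n)}{n}=1.$$
   Context: All graphs are finite and simple. For a graph $G$ and $v\in V(G)$, the graph $G-v$ (up to isomorphism) is a card of $G$; the vertex deck $\mathcal D(G)=\{G-v:v\in V(G)\}$ is a multiset. For graphs $G,H$ of the same order, the number of common cards is $b(G,H)=|\mathcal D(G)\cap\mathcal D(H)|$ (multiset intersection); equivalently, the maximum $m$ such that there are $m$ distinct vertices $v_i$ of $G$ and $m$ distinct vertices $w_i$ of $H$ with $G-v_i\cong H-w_i$ for all $i\le m$. For $n\ge 2$, $B(n)=\max b(G,H)$, the maximum being over all pairs of nonisomorphic graphs $G,H$ with $|V(G)|=|V(H)|=n$ (not required to be connected or to have the same degree sequence). Two graphs have the same degree sequence if their multisets of vertex degrees agree. -}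

module Defs where

open import Data.Bool using (Bool; true; false)
import Data.Bool.Properties as Bool
open import Data.Fin using (Fin; zero; suc; punchIn)
open import Data.Fin.Permutation using (Permutation′; permutation; _⟨$⟩ʳ_; _⟨$⟩ˡ_; inverseˡ; inverseʳ)
open import Data.Fin.Properties using (_≟_; any?; all?; injective⇒≤)
open import Data.Fin.Subset using (∣_∣)
open import Data.List using (List)
import Data.List as List
open import Data.List.Relation.Binary.Permutation.Propositional using (_↭_)
open import Data.Nat using (ℕ; zero; suc; 2+; pred; _≤_; _<_; NonTrivial; z≤n)
import Data.Nat.Properties as ℕ
open import Data.Product using (Σ; ∃; ∃₂; _×_; _,_; proj₁; proj₂)
open import Data.Rational as ℚ using (ℚ; 0ℚ)
import Data.Vec as Vec
open import Data.Vec.Functional using (_∷_; head; tail)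
import Data.Vec.Functional.Relation.Binary.Pointwise.Properties as Pointwise
open import Function using (_∘_)
open import Function.Definitions using (Injective)
open import Level using (0ℓ)
open import Relation.Binary using (Setoid; _Respects_)
open import Relation.Binary.Construct.Closure.ReflexiveTransitive using (Star)
open import Relation.Binary.PropositionalEquality using (_≡_; refl; sym; trans; cong; cong₂; setoid)
open import Relation.Nullary using (¬_; Dec; yes; no)
open import Relation.Nullary.Decidable using (map′; ¬?; _×-dec_; _→-dec_)
open import Relation.Unary using (Decidable)

------------------------------------------------------------------------
-- Graphs

record Graph (n : ℕ) : Set where
  field
    edge     : Fin n → Fin n → Bool
    edge-sym : ∀ u v → edge u v ≡ edge v u
    loopless : ∀ v → edge v v ≡ false

open Graph public

infix 4 _≅_

_≅_ : ∀ {n} → Graph n → Graph n → Set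
_≅_ {n} G H = Σ (Permutation′ n) λ π →
  ∀ u v → edge G u v ≡ edge H (π ⟨$⟩ʳ u) (π ⟨$⟩ʳ v)

Adjacent : ∀ {n} → Graph n → Fin n → Fin n → Set
Adjacent G u v = edge G u v ≡ true

Connected : ∀ {n} → Graph n → Set
Connected {n} G = ∀ (u v : Fin n) → Star (Adjacent G) u v

degree : ∀ {n} → Graph n → Fin n → ℕ
degree G v = ∣ Vec.tabulate (edge G v) ∣

degrees : ∀ {n} → Graph n → List ℕ
degrees G = List.tabulate (degree G)

SameDegreeSequence : ∀ {n} → Graph n → Graph n → Set
SameDegreeSequence G H = degrees G ↭ degrees H

infixl 6 _∖_

-- The card G − v; the remaining vertices are renumbered by punchIn v.
_∖_ : ∀ {n} → Graph n → Fin n → Graph (pred n)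
_∖_ {suc n} G v = record
  { edge     = λ i j → edge G (punchIn v i) (punchIn v j)
  ; edge-sym = λ i j → edge-sym G (punchIn v i) (punchIn v j)
  ; loopless = λ i → loopless G (punchIn v i)
  }

-- m distinct vertices of G and m distinct vertices of H whose cards agree
-- pairwise, i.e. the decks of G and H share at least m cards, counted with
-- multiplicity.
CommonCards : ∀ {n} → Graph n → Graph n → ℕ → Set
CommonCards {n} G H m = ∃₂ λ (v w : Fin m → Fin n) →
  Injective _≡_ _≡_ v × Injective _≡_ _≡_ w × (∀ i → G ∖ v i ≅ H ∖ w i)

------------------------------------------------------------------------
-- Maxima of bounded decidable sets of natural numbers

IsMaximum : (ℕ → Set) → ℕ → Set
IsMaximum P m = P m × (∀ k → P k → k ≤ m)

maximum : ∀ {P : ℕ → Set} → Decidable P →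
          ∀ N → (∀ k → P k → k ≤ N) → ∃ P → ∃ (IsMaximum P)
maximum {P} P? zero bnd (k , p) with bnd k p
... | z≤n = zero , p , bnd
maximum {P} P? (suc N) bnd e with P? (suc N)
... | yes p = suc N , p , bnd
... | no ¬p = maximum P? N bnd′ e
  where
  bnd′ : ∀ k → P k → k ≤ N
  bnd′ k p = ℕ.≤-pred (ℕ.≤∧≢⇒< (bnd k p) λ { refl → ¬p p })

IsMaximum-unique : ∀ {P Q : ℕ → Set} → (∀ {k} → P k → Q k) → (∀ {k} → Q k → P k) →
                   ∀ {m n} → IsMaximum P m → IsMaximum Q n → m ≡ n
IsMaximum-unique P⇒Q Q⇒P (p , maxp) (q , maxq) =
  ℕ.≤-antisym (maxq _ (P⇒Q p)) (maxp _ (Q⇒P q))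

------------------------------------------------------------------------
-- Decidability by exhaustive search

Searchable : Setoid 0ℓ 0ℓ → Set₁
Searchable S = ∀ {P : Carrier → Set} → P Respects _≈_ → Decidable P → Dec (∃ P)
  where open Setoid S

search-Bool : Searchable (setoid Bool)
search-Bool resp P? with P? true | P? false
... | yes p | _     = yes (true , p)
... | no _  | yes p = yes (false , p)
... | no ¬p | no ¬q = no λ { (true , p) → ¬p p ; (false , q) → ¬q q }

search-Fin : ∀ {n} → Searchable (setoid (Fin n))
search-Fin resp P? = any? P?

search-→ : ∀ {S} → Searchable S → ∀ m → Searchable (Pointwise.setoid S m)
search-→ search zero resp P? =
  map′ (λ p → _ , p) (λ (f , p) → resp (λ ()) p) (P? (λ ()))
search-→ {S} search (suc m) {P} resp P? =
  map′ (λ (x , f , p) → x ∷ f , p)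
       (λ (f , p) → head f , tail f , resp (λ { zero → S.refl ; (suc i) → S.refl }) p)
       (search
         (λ x≈y (f , p) → f , resp (λ { zero → x≈y ; (suc i) → S.refl }) p)
         (λ x → search-→ {S} search m
           (λ f≈g → resp (λ { zero → S.refl ; (suc i) → f≈g i }))
           (λ f → P? (x ∷ f))))
  where module S = Setoid S

FinFun : ℕ → ℕ → Setoid 0ℓ 0ℓ
FinFun m n = Pointwise.setoid (setoid (Fin n)) m

search-FinFun : ∀ {m n} → Searchable (FinFun m n)
search-FinFun {m} {n} = search-→ {setoid (Fin n)} search-Fin m

infix 4 _≈_

_≈_ : ∀ {n} → Graph n → Graph n → Set
G ≈ H = ∀ u v → edge G u v ≡ edge H u v

≈-sym : ∀ {n} {G H : Graph n} → G ≈ H → H ≈ G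
≈-sym e u v = sym (e u v)

graphSetoid : ℕ → Setoid 0ℓ 0ℓ
graphSetoid n = record
  { Carrier = Graph n
  ; _≈_ = _≈_
  ; isEquivalence = record
    { refl  = λ u v → refl
    ; sym   = λ e u v → sym (e u v)
    ; trans = λ e f u v → trans (e u v) (f u v)
    }
  }

search-Graph : ∀ {n} → Searchable (graphSetoid n)
search-Graph {n} {P} resp P? =
  map′ (λ (_ , s , l , p) → mk s l , p)
       (λ (G , p) → edge G , fromGraph G p)
       (search-→ {Row} (search-→ {setoid Bool} search-Bool n) n respE decE)
  where
  Row : Setoid 0ℓ 0ℓ
  Row = Pointwise.setoid (setoid Bool) n

  Sym Loopless : (Fin n → Fin n → Bool) → Set
  Sym e = ∀ u v → e u v ≡ e v u
  Loopless e = ∀ v → e v v ≡ false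

  mk : ∀ {e} → Sym e → Loopless e → Graph n
  mk {e} s l = record { edge = e ; edge-sym = s ; loopless = l }

  E : (Fin n → Fin n → Bool) → Set
  E e = Σ (Sym e) λ s → Σ (Loopless e) λ l → P (mk s l)

  fromGraph : (G : Graph n) → P G → E (edge G)
  fromGraph G p = edge-sym G , loopless G , p

  respE : ∀ {e f} → (∀ u v → e u v ≡ f u v) → E e → E f
  respE e≈f (s , l , p) =
      (λ u v → trans (sym (e≈f u v)) (trans (s u v) (e≈f v u)))
    , (λ v → trans (sym (e≈f v v)) (l v))
    , resp e≈f p

  decE : Decidable E
  decE e with all? (λ u → all? λ v → e u v Bool.≟ e v u) | all? (λ v → e v v Bool.≟ false)
  ... | no ¬s | _     = no λ (s , _) → ¬s s
  ... | yes _ | no ¬l = no λ (_ , l , _) → ¬l l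
  ... | yes s | yes l = map′ (λ p → s , l , p) (λ (_ , _ , p) → resp (λ u v → refl) p) (P? (mk s l))

_≅?_ : ∀ {n} (G H : Graph n) → Dec (G ≅ H)
_≅?_ {n} G H =
  map′ (λ (f , g , fg , gf , e) → permutation f g fg gf , e)
       (λ (π , e) → π ⟨$⟩ʳ_ , π ⟨$⟩ˡ_ , (λ _ → inverseʳ π) , (λ _ → inverseˡ π) , e)
       (search-FinFun {n} {n}
         (λ f≈f′ (g , fg , gf , e) → g
           , (λ j → trans (sym (f≈f′ (g j))) (fg j))
           , (λ i → trans (cong g (sym (f≈f′ i))) (gf i))
           , (λ u v → trans (e u v) (cong₂ (edge H) (f≈f′ u) (f≈f′ v))))
         (λ f → search-FinFun {n} {n}
           (λ g≈g′ (fg , gf , e) →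
               (λ j → trans (cong f (sym (g≈g′ j))) (fg j))
             , (λ i → trans (sym (g≈g′ (f i))) (gf i))
             , e)
           (λ g → all? (λ j → f (g j) ≟ j)
             ×-dec all? (λ i → g (f i) ≟ i)
             ×-dec all? (λ u → all? λ v → edge G u v Bool.≟ edge H (f u) (f v)))))

injective? : ∀ {m n} (f : Fin m → Fin n) → Dec (Injective _≡_ _≡_ f)
injective? f = map′ (λ h {x} {y} → h x y) (λ h x y → h)
  (all? λ x → all? λ y → (f x ≟ f y) →-dec (x ≟ y))

injective-resp : ∀ {m n} {f g : Fin m → Fin n} → (∀ i → f i ≡ g i) →
                 Injective _≡_ _≡_ f → Injective _≡_ _≡_ g
injective-resp f≈g inj {x} {y} gx≡gy = inj (trans (f≈g x) (trans gx≡gy (sym (f≈g y))))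

commonCards? : ∀ {n} (G H : Graph n) → Decidable (CommonCards G H)
commonCards? {n} G H m =
  search-FinFun {m} {n}
    (λ v≈v′ (w , iv , iw , c) → w , injective-resp v≈v′ iv , iw , λ i → substˡ (v≈v′ i) (c i))
    (λ v → search-FinFun {m} {n}
      (λ w≈w′ (iv , iw , c) → iv , injective-resp w≈w′ iw , λ i → substʳ (w≈w′ i) (c i))
      (λ w → injective? v ×-dec injective? w ×-dec all? (λ i → (G ∖ v i) ≅? (H ∖ w i))))
  where
  substˡ : ∀ {x x′ y} → x ≡ x′ → G ∖ x ≅ H ∖ y → G ∖ x′ ≅ H ∖ y
  substˡ refl c = c
  substʳ : ∀ {x y y′} → y ≡ y′ → G ∖ x ≅ H ∖ y → G ∖ x ≅ H ∖ y′
  substʳ refl c = c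

------------------------------------------------------------------------
-- The number of common cards b(G,H)

commonCards≤n : ∀ {n} (G H : Graph n) m → CommonCards G H m → m ≤ n
commonCards≤n G H m (v , w , iv , _) = injective⇒≤ iv

private
  b-max : ∀ {n} (G H : Graph n) → ∃ (IsMaximum (CommonCards G H))
  b-max {n} G H = maximum (commonCards? G H) n (commonCards≤n G H)
    (0 , (λ ()) , (λ ()) , (λ { {()} }) , (λ { {()} }) , (λ ()))

b : ∀ {n} → Graph n → Graph n → ℕ
b G H = proj₁ (b-max G H)

b-isMaximum : ∀ {n} (G H : Graph n) → IsMaximum (CommonCards G H) (b G H)
b-isMaximum G H = proj₂ (b-max G H)

b≤n : ∀ {n} (G H : Graph n) → b G H ≤ n
b≤n G H = commonCards≤n G H _ (proj₁ (b-isMaximum G H))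

------------------------------------------------------------------------
-- B(n), the maximum of b over pairs of nonisomorphic graphs of order n

≅-resp : ∀ {n} {G G′ H H′ : Graph n} → G ≈ G′ → H ≈ H′ → G ≅ H → G′ ≅ H′
≅-resp G≈G′ H≈H′ (π , e) = π , λ u v → trans (sym (G≈G′ u v)) (trans (e u v) (H≈H′ _ _))

∖-cong : ∀ {n} {G H : Graph n} (v : Fin n) → G ≈ H → G ∖ v ≈ H ∖ v
∖-cong {suc n} v e i j = e (punchIn v i) (punchIn v j)

CommonCards-resp : ∀ {n} {G G′ H H′ : Graph n} → G ≈ G′ → H ≈ H′ →
                   ∀ {m} → CommonCards G H m → CommonCards G′ H′ m
CommonCards-resp {G = G} {G′} {H} {H′} p q (v , w , iv , iw , c) = v , w , iv , iw , λ i →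
  ≅-resp {G = G ∖ v i} {G′ ∖ v i} {H ∖ w i} {H′ ∖ w i}
    (∖-cong {G = G} {G′} (v i) p) (∖-cong {G = H} {H′} (w i) q) (c i)

b-cong : ∀ {n} {G G′ H H′ : Graph n} → G ≈ G′ → H ≈ H′ → b G H ≡ b G′ H′
b-cong {G = G} {G′} {H} {H′} p q = IsMaximum-unique
  (CommonCards-resp {G = G} {G′} {H} {H′} p q)
  (CommonCards-resp {G = G′} {G} {H′} {H} (≈-sym {G = G} {G′} p) (≈-sym {G = H} {H′} q))
  (b-isMaximum G H) (b-isMaximum G′ H′)

NonisomorphicPairWithB : ℕ → ℕ → Set
NonisomorphicPairWithB n m = ∃₂ λ (G H : Graph n) → ¬ (G ≅ H) × b G H ≡ m

nonisomorphicPairWithB? : ∀ n → Decidable (NonisomorphicPairWithB n)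
nonisomorphicPairWithB? n m = search-Graph
  (λ {G} {G′} p (H , ni , eq) → H , resp {G} {G′} {H} {H} p (λ _ _ → refl) (ni , eq))
  (λ G → search-Graph
    (λ {H} {H′} q → resp {G} {G} {H} {H′} (λ _ _ → refl) q)
    (λ H → ¬? (G ≅? H) ×-dec (b G H ℕ.≟ m)))
  where
  resp : ∀ {G G′ H H′ : Graph n} → G ≈ G′ → H ≈ H′ →
         ¬ (G ≅ H) × b G H ≡ m → ¬ (G′ ≅ H′) × b G′ H′ ≡ m
  resp {G} {G′} {H} {H′} p q (ni , eq) =
      (λ iso → ni (≅-resp {G = G′} {G} {H′} {H} (≈-sym {G = G} {G′} p) (≈-sym {G = H} {H′} q) iso))
    , trans (sym (b-cong {G = G} {G′} {H} {H′} p q)) eq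

nonisomorphicPair : ∀ n .{{_ : NonTrivial n}} → ∃ (NonisomorphicPairWithB n)
nonisomorphicPair (2+ k) = _ , edgeless , oneEdge , noniso , refl
  where
  edgeless oneEdge : Graph (2+ k)
  edgeless = record
    { edge = λ _ _ → false ; edge-sym = λ _ _ → refl ; loopless = λ _ → refl }
  oneEdge = record { edge = e ; edge-sym = s ; loopless = l }
    where
    e : Fin (2+ k) → Fin (2+ k) → Bool
    e zero (suc zero) = true
    e (suc zero) zero = true
    e _ _ = false
    s : ∀ u v → e u v ≡ e v u
    s zero zero = refl
    s zero (suc zero) = refl
    s zero (suc (suc _)) = refl
    s (suc zero) zero = refl
    s (suc zero) (suc zero) = refl
    s (suc zero) (suc (suc _)) = refl
    s (suc (suc _)) zero = refl
    s (suc (suc _)) (suc zero) = refl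
    s (suc (suc _)) (suc (suc _)) = refl
    l : ∀ v → e v v ≡ false
    l zero = refl
    l (suc zero) = refl
    l (suc (suc _)) = refl

  noniso : ¬ (edgeless ≅ oneEdge)
  noniso (π , e) with () ← trans (e (π ⟨$⟩ˡ zero) (π ⟨$⟩ˡ suc zero))
                               (cong₂ (edge oneEdge) (inverseʳ π) (inverseʳ π))

private
  B-max : ∀ n .{{_ : NonTrivial n}} → ∃ (IsMaximum (NonisomorphicPairWithB n))
  B-max n = maximum (nonisomorphicPairWithB? n) n
    (λ { _ (G , H , _ , refl) → b≤n G H }) (nonisomorphicPair n)

B : ∀ n .{{_ : NonTrivial n}} → ℕ
B n = proj₁ (B-max n)

B-isMaximum : ∀ n .{{_ : NonTrivial n}} → IsMaximum (NonisomorphicPairWithB n) (B n)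
B-isMaximum n = proj₂ (B-max n)

------------------------------------------------------------------------
-- Asymptotics

InfinitelyMany : (ℕ → Set) → Set
InfinitelyMany P = ∀ N → ∃ λ n → N < n × P n

-- limsup x = L for a rational sequence x and a rational L. Both conditions are
-- monotone in ε, so rational ε > 0 give the same notion as real ε > 0.
IsLimsup : (ℕ → ℚ) → ℚ → Set
IsLimsup x L = ∀ (ε : ℚ) → 0ℚ ℚ.< ε →
    (∃ λ N → ∀ n → N ≤ n → x n ℚ.< L ℚ.+ ε)
  × InfinitelyMany (λ n → L ℚ.- ε ℚ.< x n)

{-# OPTIONS --safe #-}

-- For g labelled classes of pendant leaves with sizes K, K + 1, …, K + g − 1,
-- deleting a leaf from any class but the smallest makes two consecutive classes
-- equally large, so the transposition of these two classes becomes available.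
-- The rest of the graph has size bounded in terms of g alone. It contains a
-- vertex for every word t : Fin g → Fin g; one further vertex sees exactly the
-- words of positive sign in G and of negative sign in H, the sign being that of
-- the Vandermonde product. A transposition of classes exchanges the two signs,
-- so G and H share the cards of all leaves outside the smallest class, which is a
-- proportion tending to 1 − 1/g as K → ∞. In the undamaged graphs the leaf counts
-- are distinct, hence every isomorphism fixes each class and each word, and
-- G ≇ H.
module Submission where

open import Defs
import Algebra.Properties.CommutativeMonoid.Sum as Sum
open import Data.Bool using (Bool; true; false)
open import Data.Empty using (⊥)
open import Data.Fin as Fin using (Fin; zero; suc; toℕ; inject₁; punchIn; punchOut; fromℕ<)
open import Data.Fin.Permutation using (Permutation; Permutation′; _⟨$⟩ʳ_; remove; punchIn-permute)
open import Data.Fin.Properties as Fin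
  using (punchInᵢ≢i; punchIn-punchOut; punchOut-punchIn; toℕ-inject₁; +↔⊎; *↔×; injective⇒≤)
open import Data.Fin.Subset using (∣_∣)
open import Data.Integer as ℤ using (ℤ; +_; 0ℤ; 1ℤ)
import Data.Integer.Properties as ℤ
import Data.Integer.Solver as ℤ
import Data.List as List
import Data.List.Properties as List
open import Data.List.Relation.Binary.Permutation.Propositional using (_↭_; ↭-reflexive; ↭-trans; ↭-sym)
import Data.List.Relation.Binary.Permutation.Propositional.Properties as ↭
open import Data.Maybe using (Maybe; just; nothing)
open import Data.Nat as ℕ using (ℕ; zero; suc; 2+; _+_; _≤_; z≤n; s≤s; NonZero; NonTrivial)
import Data.Nat.Properties as ℕ
import Data.Nat.Solver as ℕ
open import Data.Product using (Σ; ∃; ∃₂; _×_; _,_; proj₁; proj₂; uncurry)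
open import Data.Product.Function.NonDependent.Propositional using (_×-↔_)
open import Data.Rational as ℚ using (ℚ; mkℚ; 0ℚ; 1ℚ; _<_; _-_; _*_; _/_; toℚᵘ)
import Data.Rational.Properties as ℚ
import Data.Rational.Solver as ℚ
open import Data.Rational.Unnormalised using (mkℚᵘ; *<*; *≤*; *≡*)
import Data.Rational.Unnormalised.Properties as ℚᵘ
open import Data.Sum using (_⊎_; inj₁; inj₂)
open import Data.Sum.Function.Propositional using (_⊎-↔_)
open import Data.Sum.Properties using (inj₁-injective)
open import Data.Vec as Vec using (Vec; []; _∷_; lookup)
open import Data.Vec.Properties using (tabulate-∘; tabulate∘lookup; tabulate-cong)
open import Function using (_∘_; _↔_; Injection; Inverse; mk↔ₛ′; mk⇔)
open import Function.Construct.Composition using (_↔-∘_)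
open import Function.Construct.Identity using (↔-id)
open import Function.Construct.Symmetry using (↔-sym)
open import Function.Properties.Inverse using (↔⇒↣)
open import Relation.Binary.Construct.Closure.ReflexiveTransitive as Star using (Star; _◅_; _◅◅_)
open import Relation.Binary.PropositionalEquality
open import Relation.Nullary using (¬_; Dec; does; yes; no; contradiction)
open import Relation.Nullary.Decidable using (dec-true; does-⇔; map′)

open Inverse using (to; from; strictlyInverseˡ; strictlyInverseʳ)

private
  variable
    A : Set
    m n : ℕ

-- Permutations acting on decks and degree sequences

involution : (f : A → A) → (∀ x → f (f x) ≡ x) → A ↔ A
involution f inv = mk↔ₛ′ f f inv inv

-- tabulate f is the sum of the singletons of f in the commutative monoid of lists up to ↭.
tabulate-↭ : (f : Fin n → A) (π : Permutation m n) →
             List.tabulate f ↭ List.tabulate (f ∘ (π ⟨$⟩ʳ_))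
tabulate-↭ {A = A} f π = ↭-trans (↭-reflexive (asSum f))
  (↭-trans (sum-permute (List.[_] ∘ f) π) (↭-reflexive (sym (asSum (f ∘ (π ⟨$⟩ʳ_))))))
  where
  open Sum (↭.++-commutativeMonoid {A = A}) using (sum; sum-permute)
  asSum : ∀ {k} (h : Fin k → A) → List.tabulate h ≡ sum (List.[_] ∘ h)
  asSum {zero}  h = refl
  asSum {suc k} h = cong (h zero List.∷_) (asSum (h ∘ suc))

∣tabulate∣-permute : (f : Fin n → Bool) (π : Permutation m n) →
               ∣ Vec.tabulate f ∣ ≡ ∣ Vec.tabulate (f ∘ (π ⟨$⟩ʳ_)) ∣
∣tabulate∣-permute f π = trans (asSum f) (trans (sum-permute (indicator ∘ f) π) (sym (asSum (f ∘ (π ⟨$⟩ʳ_)))))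
  where
  open Sum ℕ.+-0-commutativeMonoid using (sum; sum-permute)
  indicator : Bool → ℕ
  indicator true  = 1
  indicator false = 0
  asSum : ∀ {k} (h : Fin k → Bool) → ∣ Vec.tabulate h ∣ ≡ sum (indicator ∘ h)
  asSum {zero}  h = refl
  asSum {suc k} h with h zero
  ... | true  = cong suc (asSum (h ∘ suc))
  ... | false = asSum (h ∘ suc)

-- `remove v π` is the bijection that `π` induces between the remaining vertices, so adjacencies at
-- `v` never enter.
card-≅ : (G H : Graph n) (π : Permutation′ n) (v : Fin n) →
         (∀ a b → a ≢ v → b ≢ v → edge G a b ≡ edge H (π ⟨$⟩ʳ a) (π ⟨$⟩ʳ b)) →
         G ∖ v ≅ H ∖ (π ⟨$⟩ʳ v)
card-≅ {suc n} G H π v e = remove v π , λ a b →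
  trans (e _ _ (punchInᵢ≢i v a) (punchInᵢ≢i v b))
        (cong₂ (edge H) (punchIn-permute π v a) (punchIn-permute π v b))

-- A degree only counts the entries of one row, so each row may be rearranged by its own `ρ u`.
-- These need not agree with `ψ` or with one another, which leaves room for nonisomorphic graphs.
sameDegrees : (G H : Graph n) (ψ : Permutation′ n) (ρ : Fin n → Permutation′ n) →
              (∀ u v → edge G u v ≡ edge H (ψ ⟨$⟩ʳ u) (ρ u ⟨$⟩ʳ v)) → SameDegreeSequence G H
sameDegrees G H ψ ρ e = ↭-trans
  (↭-reflexive (List.tabulate-cong λ u →
    trans (cong ∣_∣ (tabulate-cong (e u))) (sym (∣tabulate∣-permute _ (ρ u)))))
  (↭-sym (tabulate-↭ (degree H) ψ))

-- A structured vertex type lets adjacency and symmetries be given by cases; `enc` carries both to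
-- `Fin n`.
module Encoded {V : Set} (enc : V ↔ Fin n) where

  encode : (E : V → V → Bool) → (∀ u v → E u v ≡ E v u) → (∀ v → E v v ≡ false) → Graph n
  encode E s l = record
    { edge     = λ u v → E (from enc u) (from enc v)
    ; edge-sym = λ u v → s _ _
    ; loopless = λ v → l _
    }

  conjugate : V ↔ V → Permutation′ n
  conjugate α = enc ↔-∘ (α ↔-∘ ↔-sym enc)

  from-conjugate : ∀ α u → from enc (conjugate α ⟨$⟩ʳ u) ≡ to α (from enc u)
  from-conjugate α u = strictlyInverseʳ enc _

  pullback : Permutation′ n → V ↔ V
  pullback π = ↔-sym enc ↔-∘ (π ↔-∘ enc)

  from≢ : ∀ {u v} → u ≢ to enc v → from enc u ≢ v
  from≢ ne eq = ne (trans (sym (strictlyInverseˡ enc _)) (cong (to enc) eq))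

-- Adjacent transpositions

-- The transposition of `inject₁ i` and `suc i`. Every index `i : Fin n` names an adjacent pair, so
-- no side condition arises.
swapF : Fin n → Fin (suc n) → Fin (suc n)
swapF zero    zero          = suc zero
swapF zero    (suc zero)    = zero
swapF zero    (suc (suc j)) = suc (suc j)
swapF (suc i) zero          = zero
swapF (suc i) (suc j)       = suc (swapF i j)

swapF-involutive : (i : Fin n) (j : Fin (suc n)) → swapF i (swapF i j) ≡ j
swapF-involutive zero    zero          = refl
swapF-involutive zero    (suc zero)    = refl
swapF-involutive zero    (suc (suc j)) = refl
swapF-involutive (suc i) zero          = refl
swapF-involutive (suc i) (suc j)       = cong suc (swapF-involutive i j)

swapV : Fin n → Vec A (suc n) → Vec A (suc n)
swapV zero    (x ∷ y ∷ zs) = y ∷ x ∷ zs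
swapV (suc i) (x ∷ ys)     = x ∷ swapV i ys

swapV-involutive : (i : Fin n) (xs : Vec A (suc n)) → swapV i (swapV i xs) ≡ xs
swapV-involutive zero    (x ∷ y ∷ zs) = refl
swapV-involutive (suc i) (x ∷ ys)     = cong (x ∷_) (swapV-involutive i ys)

lookup-swap : (i : Fin n) (xs : Vec A (suc n)) (j : Fin (suc n)) →
              lookup (swapV i xs) (swapF i j) ≡ lookup xs j
lookup-swap zero    (x ∷ y ∷ zs) zero          = refl
lookup-swap zero    (x ∷ y ∷ zs) (suc zero)    = refl
lookup-swap zero    (x ∷ y ∷ zs) (suc (suc j)) = refl
lookup-swap (suc i) (x ∷ ys)     zero          = refl
lookup-swap (suc i) (x ∷ ys)     (suc j)       = lookup-swap i ys j

map-swapV : ∀ {B : Set} (f : A → B) (i : Fin n) (xs : Vec A (suc n)) →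
            Vec.map f (swapV i xs) ≡ swapV i (Vec.map f xs)
map-swapV f zero    (x ∷ y ∷ zs) = refl
map-swapV f (suc i) (x ∷ ys)     = cong (f x ∷_) (map-swapV f i ys)

-- The fibres over inject₁ i and suc i are exchanged, except that the point of
-- the latter which e sends to nothing stays where it is.
swapΣ : (i : Fin n) (F : Fin (suc n) → Set) → F (suc i) ↔ Maybe (F (inject₁ i)) →
        Σ (Fin (suc n)) F → Σ (Fin (suc n)) F
swapΣ zero    F e (zero , b)        = suc zero , from e (just b)
swapΣ zero    F e (suc zero , a) with to e a
... | just b  = zero , b
... | nothing = suc zero , a
swapΣ zero    F e (suc (suc j) , c) = suc (suc j) , c
swapΣ (suc i) F e (zero , c)        = zero , c
swapΣ (suc i) F e (suc j , c) with swapΣ i (F ∘ suc) e (j , c)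
... | j′ , c′ = suc j′ , c′

swapΣ-involutive : (i : Fin n) (F : Fin (suc n) → Set) (e : F (suc i) ↔ Maybe (F (inject₁ i))) →
                   ∀ p → swapΣ i F e (swapΣ i F e p) ≡ p
swapΣ-involutive zero F e (zero , b) rewrite strictlyInverseˡ e (just b) = refl
swapΣ-involutive zero F e (suc zero , a) with to e a in eq
... | just b  = cong (suc zero ,_) (trans (cong (from e) (sym eq)) (strictlyInverseʳ e a))
... | nothing rewrite eq = refl
swapΣ-involutive zero    F e (suc (suc j) , c) = refl
swapΣ-involutive (suc i) F e (zero , c)        = refl
swapΣ-involutive (suc i) F e (suc j , c)
  with swapΣ i (F ∘ suc) e (j , c) | swapΣ-involutive i (F ∘ suc) e (j , c)
... | j′ , c′ | eq rewrite eq = refl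

-- The exceptional point will be the deleted leaf; as it is fixed, the same vertex is removed from
-- both graphs.
swapΣ-fixed : (i : Fin n) (F : Fin (suc n) → Set) (e : F (suc i) ↔ Maybe (F (inject₁ i))) →
              swapΣ i F e (suc i , from e nothing) ≡ (suc i , from e nothing)
swapΣ-fixed zero    F e rewrite strictlyInverseˡ e nothing = refl
swapΣ-fixed (suc i) F e rewrite swapΣ-fixed i (F ∘ suc) e  = refl

-- The exceptional point must be excluded: it stays over `suc i`, whereas `swapF i` moves `suc i` to
-- `inject₁ i`.
swapΣ-base : (i : Fin n) (F : Fin (suc n) → Set) (e : F (suc i) ↔ Maybe (F (inject₁ i))) →
             ∀ p → p ≢ (suc i , from e nothing) → proj₁ (swapΣ i F e p) ≡ swapF i (proj₁ p)
swapΣ-base zero F e (zero , b) ne = refl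
swapΣ-base zero F e (suc zero , a) ne with to e a in eq
... | just b  = refl
... | nothing = contradiction (cong (suc zero ,_) (trans (sym (strictlyInverseʳ e a)) (cong (from e) eq))) ne
swapΣ-base zero    F e (suc (suc j) , c) ne = refl
swapΣ-base (suc i) F e (zero , c)        ne = refl
swapΣ-base (suc i) F e (suc j , c)       ne = cong suc (swapΣ-base i (F ∘ suc) e (j , c)
  λ { refl → ne refl })

-- The equation absorbs the mismatch between `toℕ s` and `toℕ (inject₁ s)` in the class sizes.
delete : ∀ {m m′} → m ≡ m′ → Fin (suc m) → Fin (suc m) ↔ Maybe (Fin m′)
delete {m} refl k = mk↔ₛ′ f g fg gf
  where
  f : Fin (suc m) → Maybe (Fin m)
  f l with k Fin.≟ l
  ... | yes _ = nothing
  ... | no ne = just (punchOut ne)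
  g : Maybe (Fin m) → Fin (suc m)
  g nothing  = k
  g (just l) = punchIn k l
  fg : ∀ y → f (g y) ≡ y
  fg nothing with k Fin.≟ k
  ... | yes _ = refl
  ... | no ne = contradiction refl ne
  fg (just l) with k Fin.≟ punchIn k l
  ... | yes eq = contradiction (sym eq) (punchInᵢ≢i k l)
  ... | no ne  = cong just (trans (Fin.punchOut-cong k refl) (punchOut-punchIn k {j = l}))
  gf : ∀ x → g (f x) ≡ x
  gf l with k Fin.≟ l
  ... | yes eq = eq
  ... | no ne  = punchIn-punchOut ne

from-delete : ∀ {m m′} (eq : m ≡ m′) k → from (delete eq k) nothing ≡ k
from-delete refl k = refl

-- Vandermonde products

diffs : ℤ → Vec ℤ n → ℤ
diffs x []       = 1ℤ
diffs x (y ∷ ys) = (y ℤ.- x) ℤ.* diffs x ys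

vandermonde : Vec ℤ n → ℤ
vandermonde []       = 1ℤ
vandermonde (x ∷ xs) = diffs x xs ℤ.* vandermonde xs

diffs-swap : ∀ x (i : Fin n) ys → diffs x (swapV i ys) ≡ diffs x ys
diffs-swap x zero (y ∷ z ∷ ys) =
  solve 3 (λ a b c → b :* (a :* c) := a :* (b :* c)) refl (y ℤ.- x) (z ℤ.- x) (diffs x ys)
  where open ℤ.+-*-Solver
diffs-swap x (suc i) (y ∷ ys) = cong ((y ℤ.- x) ℤ.*_) (diffs-swap x i ys)

-- Only the factor of the exchanged pair changes sign. A swap further down merely permutes the
-- factors involving an earlier entry, by `diffs-swap`.
vandermonde-swap : (i : Fin n) (xs : Vec ℤ (suc n)) →
                   vandermonde (swapV i xs) ≡ ℤ.- vandermonde xs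
vandermonde-swap zero (x ∷ y ∷ zs) =
  solve 5 (λ x y a b c → ((x :- y) :* b) :* (a :* c) := :- (((y :- x) :* a) :* (b :* c)))
    refl x y (diffs x zs) (diffs y zs) (vandermonde zs)
  where open ℤ.+-*-Solver
vandermonde-swap (suc i) (x ∷ ys) = trans
  (cong₂ ℤ._*_ (diffs-swap x i ys) (vandermonde-swap i ys))
  (sym (ℤ.neg-distribʳ-* (diffs x ys) (vandermonde ys)))

*-positive : ∀ {i j} → 0ℤ ℤ.< i → 0ℤ ℤ.< j → 0ℤ ℤ.< i ℤ.* j
*-positive {i} {j} 0<i 0<j = subst (ℤ._< i ℤ.* j) (ℤ.*-zeroʳ i) (ℤ.*-monoˡ-<-pos i {{ℤ.positive 0<i}} 0<j)

diffs-positive : ∀ {n} x (f : Fin n → ℤ) → (∀ j → x ℤ.< f j) → 0ℤ ℤ.< diffs x (Vec.tabulate f)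
diffs-positive {zero}  x f x<f = ℤ.+<+ (s≤s z≤n)
diffs-positive {suc n} x f x<f = *-positive
  (subst (ℤ._< f zero ℤ.- x) (ℤ.+-inverseʳ x) (ℤ.+-monoˡ-< (ℤ.- x) (x<f zero)))
  (diffs-positive x (f ∘ suc) (x<f ∘ suc))

vandermonde-positive : ∀ {n} (f : Fin n → ℤ) → (∀ {i j} → i Fin.< j → f i ℤ.< f j) →
                       0ℤ ℤ.< vandermonde (Vec.tabulate f)
vandermonde-positive {zero}  f mono = ℤ.+<+ (s≤s z≤n)
vandermonde-positive {suc n} f mono = *-positive
  (diffs-positive (f zero) (f ∘ suc) (λ j → mono (s≤s z≤n)))
  (vandermonde-positive (f ∘ suc) (mono ∘ s≤s))

-- Finite types

does⁻ : ∀ {P : Set} (d : Dec P) → does d ≡ true → P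
does⁻ (yes p) _ = p

lookup-injective : ∀ {A : Set} {n} (xs ys : Vec A n) → (∀ i → lookup xs i ≡ lookup ys i) → xs ≡ ys
lookup-injective xs ys eq = trans (sym (tabulate∘lookup xs)) (trans (tabulate-cong eq) (tabulate∘lookup ys))

to-injective : ∀ {A B : Set} (e : A ↔ B) {a b} → to e a ≡ to e b → a ≡ b
to-injective e = Injection.injective (↔⇒↣ e)

Finite : Set → Set
Finite A = ∃ λ n → A ↔ Fin n

sumFin : ∀ {n} → (Fin n → ℕ) → ℕ
sumFin {zero}  f = 0
sumFin {suc n} f = f zero + sumFin (f ∘ suc)

Σ-Fin-suc : ∀ {n} {F : Fin (suc n) → Set} → Σ (Fin (suc n)) F ↔ (F zero ⊎ Σ (Fin n) (F ∘ suc))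
Σ-Fin-suc = mk↔ₛ′
  (λ { (zero , x) → inj₁ x ; (suc j , x) → inj₂ (j , x) })
  (λ { (inj₁ x) → zero , x ; (inj₂ (j , x)) → suc j , x })
  (λ { (inj₁ x) → refl ; (inj₂ (j , x)) → refl })
  (λ { (zero , x) → refl ; (suc j , x) → refl })

Σ-Fin : ∀ {n} (f : Fin n → ℕ) → Σ (Fin n) (Fin ∘ f) ↔ Fin (sumFin f)
Σ-Fin {zero}  f = mk↔ₛ′ (λ ()) (λ ()) (λ ()) (λ ())
Σ-Fin {suc n} f = ↔-sym +↔⊎ ↔-∘ ((↔-id _ ⊎-↔ Σ-Fin (f ∘ suc)) ↔-∘ Σ-Fin-suc)

Vec-finite : ∀ {A} → Finite A → ∀ n → Finite (Vec A n)
Vec-finite _       zero    = 1 , mk↔ₛ′ (λ _ → zero) (λ _ → []) (λ { zero → refl }) (λ { [] → refl })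
Vec-finite (k , e) (suc n) with Vec-finite (k , e) n
... | l , e′ = k ℕ.* l , ↔-sym *↔× ↔-∘ ((e ×-↔ e′) ↔-∘ mk↔ₛ′
  (λ { (x ∷ xs) → x , xs }) (uncurry _∷_) (λ _ → refl) (λ { (x ∷ xs) → refl }))

sumFin-≥ : ∀ {n} (f : Fin n → ℕ) K → (∀ i → K ≤ f i) → n ℕ.* K ≤ sumFin f
sumFin-≥ {zero}  f K le = z≤n
sumFin-≥ {suc n} f K le = ℕ.+-mono-≤ (le zero) (sumFin-≥ (f ∘ suc) K (le ∘ suc))

-- The graphs

module Construction (h : ℕ) where

  -- At least two positions: a transposition must exist, and a word must see two cells in order not
  -- to be pendant.
  g : ℕ
  g = 2 + h

  Word : Set
  Word = Vec (Fin g) g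

  value : Word → ℤ
  value t = vandermonde (Vec.map (+_ ∘ toℕ) t)

  value-swap : ∀ i t → value (swapV i t) ≡ ℤ.- value t
  value-swap i t = trans (cong vandermonde (map-swapV _ i t)) (vandermonde-swap i _)

  -- On words that are permutations this is the parity. A word with a repeated letter has value zero
  -- and is neither even nor odd.
  even odd : Word → Bool
  even t = does (0ℤ ℤ.<? value t)
  odd  t = does (0ℤ ℤ.<? ℤ.- value t)

  odd-swap : ∀ i t → odd (swapV i t) ≡ even t
  odd-swap i t = cong (λ z → does (0ℤ ℤ.<? z)) (trans (cong ℤ.-_ (value-swap i t)) (ℤ.neg-involutive _))

  ordered : Word
  ordered = Vec.tabulate (λ i → i)

  value-ordered : 0ℤ ℤ.< value ordered
  value-ordered = subst (λ (xs : Vec ℤ g) → 0ℤ ℤ.< vandermonde xs) (tabulate-∘ {n = g} (+_ ∘ toℕ) (λ i → i))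
    (vandermonde-positive {g} (+_ ∘ toℕ) ℤ.+<+)

  even-ordered : even ordered ≡ true
  even-ordered = dec-true (0ℤ ℤ.<? value ordered) value-ordered

  even-odd : ∀ t → even t ≡ true → odd t ≡ true → ⊥
  even-odd t e o = ℤ.<-asym (does⁻ (0ℤ ℤ.<? value t) e)
    (subst (ℤ._< 0ℤ) (ℤ.neg-involutive (value t)) (ℤ.neg-mono-< (does⁻ (0ℤ ℤ.<? ℤ.- value t) o)))

  -- mark (suc p) stands for the position p; mark zero is the vertex that sees
  -- the words of one sign.
  data Label : Set where
    class : Fin g → Label
    mark  : Fin (suc g) → Label

  class-injective : ∀ {i j} → class i ≡ class j → i ≡ j
  class-injective refl = refl

  _≟L_ : (j j′ : Label) → Dec (j ≡ j′)
  class i ≟L class j = map′ (cong class) class-injective (i Fin.≟ j)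
  class i ≟L mark q  = no λ ()
  mark q ≟L class i = no λ ()
  mark q ≟L mark p  = map′ (cong mark) (λ { refl → refl }) (q Fin.≟ p)

  swapL : Fin (suc h) → Label → Label
  swapL s (class i) = class (swapF s i)
  swapL s (mark q)  = mark q

  swapL-involutive : ∀ s j → swapL s (swapL s j) ≡ j
  swapL-involutive s (class i) = cong class (swapF-involutive s i)
  swapL-involutive s (mark q)  = refl

  -- The vertices other than the leaves of the classes, in number independent of K.
  Other : Set
  Other = Σ (Fin (suc g)) (λ q → Fin (2 + toℕ q)) ⊎ ((Fin g ⊎ Fin (suc g)) ⊎ ((Fin g × Fin g) ⊎ Word))

  Other-finite : Finite Other
  Other-finite with Vec-finite (g , ↔-id _) g
  ... | w , e = _ , ↔-sym +↔⊎ ↔-∘ (Σ-Fin _ ⊎-↔ (↔-sym +↔⊎ ↔-∘ (↔-sym +↔⊎ ⊎-↔ (↔-sym +↔⊎ ↔-∘ (↔-sym *↔× ⊎-↔ e)))))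

  -- The marks carry between `2` and `2 + g` leaves, so `big` makes every class larger than every
  -- mark and the leaf count identifies a label.
  module Sized (K : ℕ) (big : 3 + g ≤ K) where

    leaves : Label → ℕ
    leaves (class i) = toℕ i + K
    leaves (mark q)  = 2 + toℕ q

    leaves≥2 : ∀ j → 2 ≤ leaves j
    leaves≥2 (class i) = ℕ.≤-trans (ℕ.≤-trans (s≤s (s≤s z≤n)) big) (ℕ.m≤n+m K (toℕ i))
    leaves≥2 (mark q)  = s≤s (s≤s z≤n)

    leaves-class≢mark : ∀ i q → leaves (class i) ≢ leaves (mark q)
    leaves-class≢mark i q eq = ℕ.<-irrefl (sym eq)
      (ℕ.≤-trans (s≤s (s≤s (Fin.toℕ<n q))) (ℕ.≤-trans big (ℕ.m≤n+m K (toℕ i))))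

    leaves-injective : ∀ j j′ → leaves j ≡ leaves j′ → j ≡ j′
    leaves-injective (class i) (class j) eq = cong class (Fin.toℕ-injective (ℕ.+-cancelʳ-≡ K _ _ eq))
    leaves-injective (class i) (mark q) eq  = contradiction eq (leaves-class≢mark i q)
    leaves-injective (mark q) (class i) eq  = contradiction (sym eq) (leaves-class≢mark i q)
    leaves-injective (mark q) (mark p) eq   = cong mark (Fin.toℕ-injective (ℕ.+-cancelˡ-≡ 2 _ _ eq))

    -- cell i p stands for the assertion t i = p about a word t.
    data Vertex : Set where
      leaf  : (j : Label) → Fin (leaves j) → Vertex
      label : Label → Vertex
      cell  : (i p : Fin g) → Vertex
      word  : Word → Vertex

    labelCell : Label → (i p : Fin g) → Bool
    labelCell (class i)       i′ p = does (i Fin.≟ i′)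
    labelCell (mark zero)    i  p  = false
    labelCell (mark (suc q)) i  p  = does (q Fin.≟ p)

    -- The edges at `mark zero` are the only ones that depend on `act`, hence the only ones in which
    -- the two graphs differ.
    labelWord : (Word → Bool) → Label → Word → Bool
    labelWord act (mark zero) t = act t
    labelWord act _        t    = false

    adj : (Word → Bool) → Vertex → Vertex → Bool
    adj act (leaf j _) (label j′) = does (j ≟L j′)
    adj act (label j′) (leaf j _) = does (j ≟L j′)
    adj act (label j)  (cell i p) = labelCell j i p
    adj act (cell i p) (label j)  = labelCell j i p
    adj act (label j)  (word t)   = labelWord act j t
    adj act (word t)   (label j)  = labelWord act j t
    adj act (cell i p) (word t)   = does (lookup t i Fin.≟ p)
    adj act (word t)   (cell i p) = does (lookup t i Fin.≟ p)
    adj act _          _          = false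

    adj-sym : ∀ act u v → adj act u v ≡ adj act v u
    adj-sym act (leaf _ _) (leaf _ _) = refl
    adj-sym act (leaf _ _) (label _)  = refl
    adj-sym act (leaf _ _) (cell _ _) = refl
    adj-sym act (leaf _ _) (word _)   = refl
    adj-sym act (label _)  (leaf _ _) = refl
    adj-sym act (label _)  (label _)  = refl
    adj-sym act (label _)  (cell _ _) = refl
    adj-sym act (label _)  (word _)   = refl
    adj-sym act (cell _ _) (leaf _ _) = refl
    adj-sym act (cell _ _) (label _)  = refl
    adj-sym act (cell _ _) (cell _ _) = refl
    adj-sym act (cell _ _) (word _)   = refl
    adj-sym act (word _)   (leaf _ _) = refl
    adj-sym act (word _)   (label _)  = refl
    adj-sym act (word _)   (cell _ _) = refl
    adj-sym act (word _)   (word _)   = refl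

    adj-irrefl : ∀ act v → adj act v v ≡ false
    adj-irrefl act (leaf _ _) = refl
    adj-irrefl act (label _)  = refl
    adj-irrefl act (cell _ _) = refl
    adj-irrefl act (word _)   = refl

    module Graphs {order : ℕ} (enc : Vertex ↔ Fin order) where

      open Encoded enc

      graph : (Word → Bool) → Graph order
      graph act = encode (adj act) (adj-sym act) (adj-irrefl act)

      G H : Graph order
      G = graph even
      H = graph odd

      -- Cards shared after deleting a leaf outside the smallest class

      module _ (s : Fin (suc h)) (k : Fin (suc (toℕ s + K))) where

        -- Class `suc s` has exactly one leaf more than class `inject₁ s`, and `k` is the leaf left
        -- over.
        e : Fin (leaves (class (suc s))) ↔ Maybe (Fin (leaves (class (inject₁ s))))
        e = delete (cong (_+ K) (sym (toℕ-inject₁ s))) k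

        deleted : Vertex
        deleted = leaf (class (suc s)) k

        ofLeaf : Σ (Fin g) (λ i → Fin (leaves (class i))) → Vertex
        ofLeaf p = leaf (class (proj₁ p)) (proj₂ p)

        -- The transposition acts on positions: it permutes the entries of a word but leaves the
        -- letters, and with them the marks, alone.
        transposeClasses : Vertex → Vertex
        transposeClasses (leaf (class i) l) = ofLeaf (swapΣ s (λ i → Fin (leaves (class i))) e (i , l))
        transposeClasses (leaf (mark q) l)  = leaf (mark q) l
        transposeClasses (label j)          = label (swapL s j)
        transposeClasses (cell i p)         = cell (swapF s i) p
        transposeClasses (word t)           = word (swapV s t)

        transposeClasses-involutive : ∀ v → transposeClasses (transposeClasses v) ≡ v
        transposeClasses-involutive (leaf (class i) l) = cong ofLeaf (swapΣ-involutive s (λ i → Fin (leaves (class i))) e (i , l))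
        transposeClasses-involutive (leaf (mark q) l)  = refl
        transposeClasses-involutive (label j)          = cong label (swapL-involutive s j)
        transposeClasses-involutive (cell i p)         = cong (λ i → cell i p) (swapF-involutive s i)
        transposeClasses-involutive (word t)           = cong word (swapV-involutive s t)

        from-nothing : from e nothing ≡ k
        from-nothing = from-delete (cong (_+ K) (sym (toℕ-inject₁ s))) k

        transposeClasses-deleted : transposeClasses deleted ≡ deleted
        transposeClasses-deleted = subst (λ k → transposeClasses (leaf (class (suc s)) k) ≡ leaf (class (suc s)) k) from-nothing
          (cong ofLeaf (swapΣ-fixed s (λ i → Fin (leaves (class i))) e))

        -- Fails at `deleted`, which stays in its class while the label of that class moves.
        -- Elsewhere leaf and label move together, and equality of labels is reflected because
        -- `swapL s` is an involution.
        leaf-label : ∀ j (l : Fin (leaves j)) j′ → leaf j l ≢ deleted →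
                     adj even (leaf j l) (label j′) ≡ adj odd (transposeClasses (leaf j l)) (label (swapL s j′))
        leaf-label (mark q) l (class i) ne = refl
        leaf-label (mark q) l (mark p) ne  = refl
        leaf-label (class i) l j′ ne       = trans
          (does-⇔ (mk⇔ (cong (swapL s)) λ eq → trans (sym (swapL-involutive s (class i))) (trans (cong (swapL s) eq) (swapL-involutive s j′)))
            (class i ≟L j′) (class (swapF s i) ≟L swapL s j′))
          (cong (λ i → does (class i ≟L swapL s j′)) (sym (swapΣ-base s (λ i → Fin (leaves (class i))) e (i , l)
            λ eq → ne (trans (cong ofLeaf eq) (cong (leaf (class (suc s))) from-nothing)))))

        swap-≟ : ∀ i j → does (i Fin.≟ j) ≡ does (swapF s i Fin.≟ swapF s j)
        swap-≟ i j = does-⇔ (mk⇔ (cong (swapF s)) λ eq →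
          trans (sym (swapF-involutive s i)) (trans (cong (swapF s) eq) (swapF-involutive s j))) (i Fin.≟ j) (swapF s i Fin.≟ swapF s j)

        label-cell : ∀ j i p → labelCell j i p ≡ labelCell (swapL s j) (swapF s i) p
        label-cell (class j)       i p = swap-≟ j i
        label-cell (mark zero)    i p  = refl
        label-cell (mark (suc q)) i p  = refl

        -- This is where `even` turns into `odd`: exchanging two entries of a word negates its
        -- Vandermonde product.
        label-word : ∀ j t → labelWord even j t ≡ labelWord odd (swapL s j) (swapV s t)
        label-word (class i)       t = refl
        label-word (mark zero)    t  = sym (odd-swap s t)
        label-word (mark (suc q)) t  = refl

        cell-word : ∀ i p (t : Word) → does (lookup t i Fin.≟ p) ≡ does (lookup (swapV s t) (swapF s i) Fin.≟ p)
        cell-word i p t = cong (λ q → does (q Fin.≟ p)) (sym (lookup-swap s t i))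

        transposeClasses-adj : ∀ u v → u ≢ deleted → v ≢ deleted → adj even u v ≡ adj odd (transposeClasses u) (transposeClasses v)
        transposeClasses-adj (leaf (class _) _) (leaf (class _) _) _ _ = refl
        transposeClasses-adj (leaf (class _) _) (leaf (mark _) _) _ _  = refl
        transposeClasses-adj (leaf (mark _) _) (leaf (class _) _) _ _  = refl
        transposeClasses-adj (leaf (mark _) _) (leaf (mark _) _) _ _   = refl
        transposeClasses-adj (leaf j l)     (label j′)     u≢ _        = leaf-label j l j′ u≢
        transposeClasses-adj (leaf (class _) _) (cell _ _)     _ _     = refl
        transposeClasses-adj (leaf (mark _) _) (cell _ _)     _ _      = refl
        transposeClasses-adj (leaf (class _) _) (word _)       _ _     = refl
        transposeClasses-adj (leaf (mark _) _) (word _)       _ _      = refl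
        transposeClasses-adj (label j′)     (leaf j l)     _ v≢        = trans (leaf-label j l j′ v≢) (adj-sym odd (transposeClasses (leaf j l)) (label (swapL s j′)))
        transposeClasses-adj (label _)      (label _)      _ _         = refl
        transposeClasses-adj (label j)      (cell i p)     _ _         = label-cell j i p
        transposeClasses-adj (label j)      (word t)       _ _         = label-word j t
        transposeClasses-adj (cell _ _)     (leaf (class _) _) _ _     = refl
        transposeClasses-adj (cell _ _)     (leaf (mark _) _) _ _      = refl
        transposeClasses-adj (cell i p)     (label j)      _ _         = label-cell j i p
        transposeClasses-adj (cell _ _)     (cell _ _)     _ _         = refl
        transposeClasses-adj (cell i p)     (word t)       _ _         = cell-word i p t
        transposeClasses-adj (word _)       (leaf (class _) _) _ _     = refl
        transposeClasses-adj (word _)       (leaf (mark _) _) _ _      = refl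
        transposeClasses-adj (word t)       (label j)      _ _         = label-word j t
        transposeClasses-adj (word t)       (cell i p)     _ _         = cell-word i p t
        transposeClasses-adj (word _)       (word _)       _ _         = refl

        -- `card-≅` removes the image of `deleted` from `H`; the `subst` identifies this image with
        -- `deleted` itself.
        common-card : G ∖ to enc deleted ≅ H ∖ to enc deleted
        common-card = subst (λ w → G ∖ to enc deleted ≅ H ∖ w)
          (cong (to enc) (trans (cong transposeClasses (strictlyInverseʳ enc deleted)) transposeClasses-deleted))
          (card-≅ G H (conjugate (involution transposeClasses transposeClasses-involutive)) (to enc deleted) λ a b a≢ b≢ →
            trans (transposeClasses-adj _ _ (from≢ a≢) (from≢ b≢))
              (sym (cong₂ (adj odd) (from-conjugate (involution transposeClasses transposeClasses-involutive) a) (from-conjugate (involution transposeClasses transposeClasses-involutive) b))))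

      -- Connectedness

      module _ (act : Word → Bool) (w₀ : Word) (active : act w₀ ≡ true) where

        Path : Vertex → Vertex → Set
        Path = Star (λ u v → adj act u v ≡ true)

        reverse : ∀ {u v} → Path u v → Path v u
        reverse = Star.reverse λ {u} {v} e → trans (adj-sym act v u) e

        base : Vertex
        base = cell zero zero

        ≟-refl : ∀ {n} (i : Fin n) → does (i Fin.≟ i) ≡ true
        ≟-refl i = dec-true (i Fin.≟ i) refl

        cell-class : ∀ i p → Path (cell i p) (label (class i))
        cell-class i p = ≟-refl i ◅ Star.ε

        cell-mark : ∀ i p → Path (cell i p) (label (mark (suc p)))
        cell-mark i p = ≟-refl p ◅ Star.ε

        word-base : ∀ t → Path (word t) base
        cell-base : ∀ i p → Path (cell i p) base
        -- The path runs through `class i`, `cell i zero` and `mark (suc zero)` to `cell zero zero`.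
        cell-base i p = cell-class i p ◅◅ reverse (cell-class i zero) ◅◅ cell-mark i zero ◅◅ reverse (cell-mark zero zero)
        word-base t = _◅_ {j = cell zero (lookup t zero)} (≟-refl (lookup t zero)) (cell-base zero (lookup t zero))

        label-base : ∀ j → Path (label j) base
        label-base (class i)      = reverse (cell-class i zero) ◅◅ cell-base i zero
        -- Apart from its own leaves, `mark zero` sees only words selected by `act`, so `w₀` is its
        -- link to the rest.
        label-base (mark zero)    = _◅_ {j = word w₀} active (word-base w₀)
        label-base (mark (suc p)) = reverse (cell-mark zero p) ◅◅ cell-base zero p

        to-base : ∀ v → Path v base
        to-base (leaf j l) = _◅_ {j = label j} (dec-true (j ≟L j) refl) (label-base j)
        to-base (label j)  = label-base j
        to-base (cell i p) = cell-base i p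
        to-base (word t)   = word-base t

        connected : Connected (graph act)
        connected u v = subst₂ (Star (Adjacent (graph act))) (strictlyInverseˡ enc u) (strictlyInverseˡ enc v)
          (Star.gmap (to enc) (λ {a} {b} e → trans (cong₂ (adj act) (strictlyInverseʳ enc a) (strictlyInverseʳ enc b)) e)
            (to-base (from enc u) ◅◅ reverse (to-base (from enc v))))

      G-connected : Connected G
      G-connected = connected even ordered even-ordered

      H-connected : Connected H
      -- One swap turns the even word `ordered` into an odd one.
      H-connected = connected odd (swapV zero ordered) (trans (odd-swap zero ordered) even-ordered)

      -- Equality of the degree sequences

      reorderWord : Vertex → Vertex
      reorderWord (word t) = word (swapV zero t)
      reorderWord v        = v

      reorderBoth : Vertex → Vertex
      reorderBoth (cell i p) = cell (swapF zero i) p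
      reorderBoth v          = reorderWord v

      reorderWord↔ reorderBoth↔ : Vertex ↔ Vertex
      reorderWord↔ = involution reorderWord λ
        { (leaf j l) → refl ; (label j) → refl ; (cell i p) → refl
        ; (word t) → cong word (swapV-involutive zero t) }
      reorderBoth↔ = involution reorderBoth λ
        { (leaf j l) → refl ; (label j) → refl
        ; (cell i p) → cong (λ i → cell i p) (swapF-involutive zero i)
        ; (word t) → cong word (swapV-involutive zero t) }

      -- Swapping two entries of every word exchanges the signs seen by `mark zero`. Rows of words
      -- also need their cells swapped, while rows of labels keep the cells in place; this
      -- discrepancy keeps the matching of degrees from being an isomorphism.
      row : Vertex → Vertex ↔ Vertex
      row (leaf j l) = ↔-id _
      row (label j)  = reorderWord↔
      row (cell i p) = ↔-id _
      row (word t)   = reorderBoth↔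

      labelWord-swap : ∀ j t → labelWord even j t ≡ labelWord odd j (swapV zero t)
      labelWord-swap (class i)       t = refl
      labelWord-swap (mark zero)    t  = sym (odd-swap zero t)
      labelWord-swap (mark (suc q)) t  = refl

      row-adj : ∀ u v → adj even u v ≡ adj odd (reorderWord u) (to (row u) v)
      row-adj (leaf _ _) (leaf _ _) = refl
      row-adj (leaf _ _) (label _)  = refl
      row-adj (leaf _ _) (cell _ _) = refl
      row-adj (leaf _ _) (word _)   = refl
      row-adj (label _)  (leaf _ _) = refl
      row-adj (label _)  (label _)  = refl
      row-adj (label _)  (cell _ _) = refl
      row-adj (label j)  (word t)   = labelWord-swap j t
      row-adj (cell _ _) (leaf _ _) = refl
      row-adj (cell _ _) (label _)  = refl
      row-adj (cell _ _) (cell _ _) = refl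
      row-adj (cell _ _) (word _)   = refl
      row-adj (word _)   (leaf _ _) = refl
      row-adj (word t)   (label j)  = labelWord-swap j t
      row-adj (word t)   (cell i p) = cong (λ q → does (q Fin.≟ p)) (sym (lookup-swap zero t i))
      row-adj (word _)   (word _)   = refl

      sameDegreeSequence : SameDegreeSequence G H
      sameDegreeSequence = sameDegrees G H (conjugate reorderWord↔) (λ u → conjugate (row (from enc u))) λ u v →
        trans (row-adj (from enc u) (from enc v))
          (sym (cong₂ (adj odd) (from-conjugate reorderWord↔ u) (from-conjugate (row (from enc u)) v)))

      -- Nonisomorphism

      Pendant : (Word → Bool) → Vertex → Set
      Pendant act v = ∀ u w → adj act v u ≡ true → adj act v w ≡ true → u ≡ w

      leaf-neighbour : ∀ act {j l} v → adj act (leaf j l) v ≡ true → v ≡ label j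
      leaf-neighbour act {j} (label j′) e = cong label (sym (does⁻ (j ≟L j′) e))

      pendant-leaf : ∀ act j l → Pendant act (leaf j l)
      pendant-leaf act j l u w e f = trans (leaf-neighbour act u e) (sym (leaf-neighbour act w f))

      -- Every other vertex has two distinct neighbours: two leaves of a label, the class and the
      -- mark of a cell, or the cells of a word at its first two positions.
      pendant⇒leaf : ∀ act v → Pendant act v → ∃₂ λ j l → v ≡ leaf j l
      pendant⇒leaf act (leaf j l) _      = j , l , refl
      -- These are the leaves numbered 1 and 0, told apart by `index`.
      pendant⇒leaf act (label j) pendant = contradiction (pendant (leaf j (fromℕ< (leaves≥2 j)))
        (leaf j (fromℕ< (ℕ.<⇒≤ (leaves≥2 j)))) (dec-true (j ≟L j) refl) (dec-true (j ≟L j) refl))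
        λ eq → contradiction (trans (sym (Fin.toℕ-fromℕ< (leaves≥2 j))) (trans (cong index eq) (Fin.toℕ-fromℕ< (ℕ.<⇒≤ (leaves≥2 j))))) λ ()
        where
        index : Vertex → ℕ
        index (leaf j l) = toℕ l
        index _          = 0
      pendant⇒leaf act (cell i p) pendant
        with () ← pendant (label (class i)) (label (mark (suc p))) (dec-true (i Fin.≟ i) refl) (dec-true (p Fin.≟ p) refl)
      pendant⇒leaf act (word t) pendant
        with () ← pendant (cell zero (lookup t zero)) (cell (suc zero) (lookup t (suc zero)))
          (dec-true (lookup t zero Fin.≟ lookup t zero) refl) (dec-true (lookup t (suc zero) Fin.≟ lookup t (suc zero)) refl)

      module _ (act act′ : Word → Bool) (φ : Vertex ↔ Vertex)
               (φ-adj : ∀ u v → adj act u v ≡ adj act′ (to φ u) (to φ v)) where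

        φ⁻¹-adj : ∀ u v → adj act′ u v ≡ adj act (from φ u) (from φ v)
        φ⁻¹-adj u v = sym (trans (φ-adj (from φ u) (from φ v)) (cong₂ (adj act′) (strictlyInverseˡ φ u) (strictlyInverseˡ φ v)))

        pendant-image : ∀ v → Pendant act v → Pendant act′ (to φ v)
        pendant-image v pendant u w e f = trans (sym (strictlyInverseˡ φ u)) (trans
          (cong (to φ) (pendant (from φ u) (from φ w) (pull u e) (pull w f))) (strictlyInverseˡ φ w))
          where
          pull : ∀ u → adj act′ (to φ v) u ≡ true → adj act v (from φ u) ≡ true
          pull u e = trans (φ-adj v (from φ u)) (trans (cong (adj act′ (to φ v)) (strictlyInverseˡ φ u)) e)

        -- The image of a leaf is pendant, hence a leaf, and the image of `label j` must be the sole
        -- neighbour of that leaf.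
        leaf-image : ∀ j l → ∃ λ j′ → to φ (label j) ≡ label j′ × ∃ λ l′ → to φ (leaf j l) ≡ leaf j′ l′
        leaf-image j l with pendant⇒leaf act′ _ (pendant-image _ (pendant-leaf act j l))
        ... | j′ , l′ , eq = j′ , leaf-neighbour act′ _
          (trans (cong (λ v → adj act′ v (to φ (label j))) (sym eq))
            (trans (sym (φ-adj (leaf j l) (label j))) (dec-true (j ≟L j) refl))) , l′ , eq

        label-injective : ∀ {j j′} → label j ≡ label j′ → j ≡ j′
        label-injective refl = refl

        -- `φ` embeds the leaves at `j` into those at `j′`. Only an inequality results; applying the
        -- lemma to the inverse gives the other one.
        label-image : ∀ j → ∃ λ j′ → to φ (label j) ≡ label j′ × leaves j ≤ leaves j′
        label-image j with leaf-image j (fromℕ< (ℕ.<⇒≤ (leaves≥2 j)))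
        ... | j′ , φj≡j′ , _ = j′ , φj≡j′ , injective⇒≤ {f = proj₁ ∘ image} λ {l} {l′} eq →
          leaf-injective (to-injective φ (trans (proj₂ (image l)) (trans (cong (leaf j′) eq) (sym (proj₂ (image l′))))))
          where
          image : ∀ l → ∃ λ l′ → to φ (leaf j l) ≡ leaf j′ l′
          image l with leaf-image j l
          -- All leaves at `j` land at the same label, since `label j` has a single image.
          ... | i , φj≡i , l′ , eq with refl ← label-injective (trans (sym φj≡j′) φj≡i) = l′ , eq
          leaf-injective : ∀ {l l′} → leaf j l ≡ leaf j l′ → l ≡ l′
          leaf-injective refl = refl

      noniso : ¬ (G ≅ H)
      noniso (π , π-edge) = impossible
        where
        φ : Vertex ↔ Vertex
        φ = pullback π

        φ-adj : ∀ u v → adj even u v ≡ adj odd (to φ u) (to φ v)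
        φ-adj u v = trans (sym (cong₂ (adj even) (strictlyInverseʳ enc u) (strictlyInverseʳ enc v))) (π-edge (to enc u) (to enc v))

        label-fixed : ∀ j → to φ (label j) ≡ label j
        label-fixed j with label-image even odd φ φ-adj j
        -- The inverse leads from `j′` back to `j`, so both have equally many leaves and coincide.
        ... | j′ , φj≡j′ , le with label-image odd even (↔-sym φ) (φ⁻¹-adj even odd φ φ-adj) j′
        ... | j″ , φ⁻¹j′≡j″ , le′
          with refl ← label-injective even odd φ φ-adj {j} {j″} (trans (sym (strictlyInverseʳ φ (label j))) (trans (cong (from φ) φj≡j′) φ⁻¹j′≡j″))
          = trans φj≡j′ (cong label (leaves-injective j′ j (ℕ.≤-antisym le′ le)))

        -- A leaf sees a single label, a word none but possibly `mark zero`, and labels do not see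
        -- each other. Only a cell can see both a class and a positive mark, and these give its
        -- coordinates.
        cell-unique : ∀ i p v → adj odd v (label (class i)) ≡ true → adj odd v (label (mark (suc p))) ≡ true → v ≡ cell i p
        cell-unique i p (leaf j l) e f
          with () ← trans (sym (does⁻ (j ≟L class i) e)) (does⁻ (j ≟L mark (suc p)) f)
        cell-unique i p (cell i′ p′) e f = cong₂ cell (sym (does⁻ (i Fin.≟ i′) e)) (sym (does⁻ (p Fin.≟ p′) f))

        to-label : ∀ u j → adj even u (label j) ≡ true → adj odd (to φ u) (label j) ≡ true
        to-label u j e = trans (cong (adj odd (to φ u)) (sym (label-fixed j))) (trans (sym (φ-adj u (label j))) e)

        cell-fixed : ∀ i p → to φ (cell i p) ≡ cell i p
        cell-fixed i p = cell-unique i p (to φ (cell i p)) (to-label (cell i p) (class i) (dec-true (i Fin.≟ i) refl))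
          (to-label (cell i p) (mark (suc p)) (dec-true (p Fin.≟ p) refl))

        -- The neighbours of `mark zero` are its leaves and the odd words. Leaves see no cell, and a
        -- word is spelled out by its cells.
        word-unique : ∀ t v → adj odd v (label (mark zero)) ≡ true →
                      (∀ i → adj odd v (cell i (lookup t i)) ≡ true) → odd t ≡ true
        word-unique t (word t′) e f = trans (cong odd (lookup-injective t t′ λ i → sym (does⁻ (lookup t′ i Fin.≟ lookup t i) (f i)))) e
        word-unique t (leaf j l) e f with () ← f zero

        impossible : ⊥
        -- The image of `word ordered` still sees `mark zero` and the cells spelling `ordered`,
        -- which would make `ordered` odd.
        impossible = even-odd ordered even-ordered (word-unique ordered (to φ (word ordered))
          (to-label (word ordered) (mark zero) even-ordered) λ i →
            trans (cong (adj odd (to φ (word ordered))) (sym (cell-fixed i (lookup ordered i))))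
              (trans (sym (φ-adj (word ordered) (cell i (lookup ordered i)))) (dec-true (lookup ordered i Fin.≟ lookup ordered i) refl)))

    -- Counting the vertices and the shared cards

    good : ℕ
    good = sumFin {suc h} (λ i → suc (toℕ i + K))

    rest : ℕ
    rest = K + proj₁ Other-finite

    order : ℕ
    order = good + rest

    -- The first summand collects the leaves whose deletion gives a common card, so `commonCards`
    -- can enumerate them directly.
    split : Vertex ↔ (Σ (Fin (suc h)) (λ i → Fin (suc (toℕ i + K))) ⊎ (Fin K ⊎ Other))
    split = mk↔ₛ′ f f⁻¹ ff⁻¹ f⁻¹f
      where
      f : Vertex → _
      f (leaf (class zero) k)    = inj₂ (inj₁ k)
      f (leaf (class (suc i)) k) = inj₁ (i , k)
      f (leaf (mark q) k)        = inj₂ (inj₂ (inj₁ (q , k)))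
      f (label (class i))        = inj₂ (inj₂ (inj₂ (inj₁ (inj₁ i))))
      f (label (mark q))         = inj₂ (inj₂ (inj₂ (inj₁ (inj₂ q))))
      f (cell i p)               = inj₂ (inj₂ (inj₂ (inj₂ (inj₁ (i , p)))))
      f (word t)                 = inj₂ (inj₂ (inj₂ (inj₂ (inj₂ t))))
      f⁻¹ : _ → Vertex
      f⁻¹ (inj₂ (inj₁ k))                            = leaf (class zero) k
      f⁻¹ (inj₁ (i , k))                             = leaf (class (suc i)) k
      f⁻¹ (inj₂ (inj₂ (inj₁ (q , k))))               = leaf (mark q) k
      f⁻¹ (inj₂ (inj₂ (inj₂ (inj₁ (inj₁ i)))))       = label (class i)
      f⁻¹ (inj₂ (inj₂ (inj₂ (inj₁ (inj₂ q)))))       = label (mark q)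
      f⁻¹ (inj₂ (inj₂ (inj₂ (inj₂ (inj₁ (i , p)))))) = cell i p
      f⁻¹ (inj₂ (inj₂ (inj₂ (inj₂ (inj₂ t)))))       = word t
      ff⁻¹ : ∀ y → f (f⁻¹ y) ≡ y
      ff⁻¹ (inj₂ (inj₁ k))                            = refl
      ff⁻¹ (inj₁ (i , k))                             = refl
      ff⁻¹ (inj₂ (inj₂ (inj₁ (q , k))))               = refl
      ff⁻¹ (inj₂ (inj₂ (inj₂ (inj₁ (inj₁ i)))))       = refl
      ff⁻¹ (inj₂ (inj₂ (inj₂ (inj₁ (inj₂ q)))))       = refl
      ff⁻¹ (inj₂ (inj₂ (inj₂ (inj₂ (inj₁ (i , p)))))) = refl
      ff⁻¹ (inj₂ (inj₂ (inj₂ (inj₂ (inj₂ t)))))       = refl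
      f⁻¹f : ∀ v → f⁻¹ (f v) ≡ v
      f⁻¹f (leaf (class zero) k)    = refl
      f⁻¹f (leaf (class (suc i)) k) = refl
      f⁻¹f (leaf (mark q) k)        = refl
      f⁻¹f (label (class i))        = refl
      f⁻¹f (label (mark q))         = refl
      f⁻¹f (cell i p)               = refl
      f⁻¹f (word t)                 = refl

    enc : Vertex ↔ Fin order
    enc = ↔-sym +↔⊎ ↔-∘ ((Σ-Fin _ ⊎-↔ (↔-sym +↔⊎ ↔-∘ (↔-id _ ⊎-↔ proj₂ Other-finite))) ↔-∘ split)

    open Graphs enc

    commonCards : CommonCards G H good
    commonCards = v , v , v-injective , v-injective , λ i → uncurry common-card (from (Σ-Fin _) i)
      where
      v : Fin good → Fin order
      v i = to enc (from split (inj₁ (from (Σ-Fin _) i)))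
      v-injective : ∀ {i j} → v i ≡ v j → i ≡ j
      v-injective eq = to-injective (↔-sym (Σ-Fin _)) (inj₁-injective
        (to-injective (↔-sym split) (to-injective enc eq)))

-- Rational estimates

-- A positive rational is at least the reciprocal of its denominator, so comparing with that
-- denominator reduces the claim to natural numbers.
<-scaled : ∀ {ε} → 0ℚ < ε → ∀ r n → ℚ.↧ₙ ε ℕ.* r ℕ.< n → + r / 1 < ε * (+ n / 1)
<-scaled {ε@(mkℚ (+ zero)  d _)} (ℚ.*<* (ℤ.+<+ ())) r n lt
<-scaled {ε@(mkℚ (+ suc p) d _)} _ r n lt = ℚ.toℚᵘ-cancel-< (ℚᵘ.<-respˡ-≃ (ℚᵘ.≃-sym (ℚ.toℚᵘ-fromℚᵘ (mkℚᵘ (+ r) 0)))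
  (ℚᵘ.<-respʳ-≃ (ℚᵘ.≃-sym (ℚᵘ.≃-trans (ℚ.toℚᵘ-homo-* ε (+ n / 1)) (ℚᵘ.*-congˡ {toℚᵘ ε} (ℚ.toℚᵘ-fromℚᵘ (mkℚᵘ (+ n) 0)))))
    (*<* (subst₂ ℤ._<_ (ℤ.pos-* r (suc d ℕ.* 1)) (trans (ℤ.pos-* (suc p) n) (sym (ℤ.*-identityʳ _))) (ℤ.+<+ bound)))))
  where
  open ℕ.≤-Reasoning
  bound : r ℕ.* (suc d ℕ.* 1) ℕ.< suc p ℕ.* n
  bound = begin-strict
    r ℕ.* (suc d ℕ.* 1) ≡⟨ cong (r ℕ.*_) (ℕ.*-identityʳ (suc d)) ⟩
    r ℕ.* suc d         ≡⟨ ℕ.*-comm r (suc d) ⟩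
    suc d ℕ.* r         <⟨ lt ⟩
    n                   ≤⟨ ℕ.m≤m+n n (p ℕ.* n) ⟩
    suc p ℕ.* n         ∎

/1-+ : ∀ a b → + (a + b) / 1 ≡ (+ a / 1) ℚ.+ (+ b / 1)
/1-+ a b = ℚ.toℚᵘ-injective (ℚᵘ.≃-trans (ℚ.toℚᵘ-fromℚᵘ (mkℚᵘ (+ (a + b)) 0))
  (ℚᵘ.≃-sym (ℚᵘ.≃-trans (ℚ.toℚᵘ-homo-+ (+ a / 1) (+ b / 1))
    (ℚᵘ.≃-trans (ℚᵘ.+-cong (ℚ.toℚᵘ-fromℚᵘ (mkℚᵘ (+ a) 0)) (ℚ.toℚᵘ-fromℚᵘ (mkℚᵘ (+ b) 0)))
      (*≡* (cong (ℤ._* + 1) (trans (cong₂ ℤ._+_ (ℤ.*-identityʳ (+ a)) (ℤ.*-identityʳ (+ b))) (sym (ℤ.pos-+ a b)))))))))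

/1-mono-≤ : ∀ {a b} → a ≤ b → + a / 1 ℚ.≤ + b / 1
/1-mono-≤ {a} {b} a≤b = ℚ.toℚᵘ-cancel-≤ (ℚᵘ.≤-respˡ-≃ (ℚᵘ.≃-sym (ℚ.toℚᵘ-fromℚᵘ (mkℚᵘ (+ a) 0)))
  (ℚᵘ.≤-respʳ-≃ (ℚᵘ.≃-sym (ℚ.toℚᵘ-fromℚᵘ (mkℚᵘ (+ b) 0)))
    (*≤* (ℤ.*-monoʳ-≤-nonNeg (+ 1) (ℤ.+≤+ a≤b)))))

/1-scaled : ∀ a n .{{_ : NonZero n}} → (+ a / n) * (+ n / 1) ≡ + a / 1
/1-scaled a n@(suc n-1) = ℚ.toℚᵘ-injective (ℚᵘ.≃-trans (ℚ.toℚᵘ-homo-* (+ a / n) (+ n / 1))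
  (ℚᵘ.≃-trans (ℚᵘ.*-cong (ℚ.toℚᵘ-fromℚᵘ (mkℚᵘ (+ a) n-1)) (ℚ.toℚᵘ-fromℚᵘ (mkℚᵘ (+ n) 0)))
    (ℚᵘ.≃-trans (*≡* (ℤ.*-assoc (+ a) (+ n) (+ 1)))
      (ℚᵘ.≃-sym (ℚ.toℚᵘ-fromℚᵘ (mkℚᵘ (+ a) 0))))))

ratio≤1 : ∀ a n .{{_ : NonZero n}} → a ≤ n → + a / n ℚ.≤ 1ℚ
ratio≤1 a n a≤n = ℚ.*-cancelʳ-≤-pos (+ n / 1) {{ℚ.normalize-pos n 1}}
  (subst₂ ℚ._≤_ (sym (/1-scaled a n)) (sym (ℚ.*-identityˡ (+ n / 1))) (/1-mono-≤ a≤n))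

<-ratio : ∀ {y} a n .{{_ : NonZero n}} → y * (+ n / 1) < + a / 1 → y < + a / n
<-ratio {y} a n lt = ℚ.*-cancelʳ-<-nonNeg (+ n / 1) {{ℚ.normalize-nonNeg n 1}}
  (subst (y * (+ n / 1) <_) (sym (/1-scaled a n)) lt)

-- The `r` vertices without a guaranteed common card make up less than the fraction `ε` of all
-- `m + r`, so `m` exceeds the remaining fraction.
1-ε-bound : ∀ {ε} → 0ℚ < ε → ∀ m r b → m ≤ b → ℚ.↧ₙ ε ℕ.* r ℕ.< m + r →
      (1ℚ - ε) * (+ (m + r) / 1) < + b / 1
1-ε-bound {ε} 0<ε m r b m≤b lt = ℚ.<-≤-trans (begin-strict
  (1ℚ - ε) * T          ≡⟨ solve 2 (λ e n → (con 1ℚ :- e) :* n := n :- e :* n) refl ε T ⟩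
  T - ε * T             ≡⟨ cong (_- ε * T) (/1-+ m r) ⟩
  (M ℚ.+ R) - ε * T     <⟨ ℚ.+-monoˡ-< (ℚ.- (ε * T)) (ℚ.+-monoʳ-< M (<-scaled 0<ε r (m + r) lt)) ⟩
  (M ℚ.+ ε * T) - ε * T ≡⟨ solve 2 (λ m x → (m :+ x) :- x := m) refl M (ε * T) ⟩
  M                     ∎) (/1-mono-≤ m≤b)
  where
  open ℚ.≤-Reasoning
  open ℚ.+-*-Solver
  T M R : ℚ
  T = + (m + r) / 1
  M = + m / 1
  R = + r / 1

-- Choice of the parameters

module Family (d N : ℕ) where

  -- Beyond the smallest class there are `2 * d + 1` classes of more than `K` leaves each. As `rest`
  -- will be at most `2 * K`, this makes `d * rest` smaller than `order`.
  open Construction (2 ℕ.* d)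

  others K : ℕ
  others = proj₁ Other-finite
  -- The summand `others` bounds `rest` by `2 * K`, `3 + g` satisfies `big`, and `N` pushes the
  -- order beyond `N`.
  K = others + (3 + g + N)

  open Sized K (ℕ.≤-trans (ℕ.m≤m+n (3 + g) N) (ℕ.m≤n+m _ others)) public

  good-bound : suc (2 ℕ.* d) ℕ.* K ≤ good
  good-bound = sumFin-≥ {suc (2 ℕ.* d)} (λ i → suc (toℕ i + K)) K λ i → ℕ.m≤n⇒m≤1+n (ℕ.m≤n+m K (toℕ i))

  N<order : N ℕ.< order
  N<order = begin-strict
    N         <⟨ s≤s (ℕ.m≤n+m N (2 + g)) ⟩
    3 + g + N ≤⟨ ℕ.m≤n+m _ others ⟩
    K         ≤⟨ ℕ.m≤m+n K others ⟩
    rest      ≤⟨ ℕ.m≤n+m rest good ⟩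
    order     ∎
    where open ℕ.≤-Reasoning

  rest-small : d ℕ.* rest ℕ.< order
  rest-small = begin-strict
    d ℕ.* (K + others)  ≤⟨ ℕ.*-monoʳ-≤ d (ℕ.+-monoʳ-≤ K (ℕ.m≤m+n others _)) ⟩
    d ℕ.* (K + K)       ≡⟨ solve 2 (λ d k → d :* (k :+ k) := con 2 :* d :* k) refl d K ⟩
    2 ℕ.* d ℕ.* K       ≤⟨ ℕ.m≤n+m _ K ⟩
    suc (2 ℕ.* d) ℕ.* K ≤⟨ good-bound ⟩
    good                <⟨ ℕ.m<m+n good (ℕ.≤-trans (ℕ.≤-trans (s≤s z≤n) (ℕ.m≤n+m (3 + g + N) others)) (ℕ.m≤m+n K others)) ⟩
    order               ∎
    where
    open ℕ.≤-Reasoning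
    open ℕ.+-*-Solver

-- Infinitely many orders and the limit superior

B≤n : ∀ n .{{_ : NonTrivial n}} → B n ≤ n
B≤n n = bound (proj₁ (B-isMaximum n))
  where
  bound : ∀ {m} → NonisomorphicPairWithB n m → m ≤ n
  bound (G , H , _ , refl) = b≤n G H

b≤B : ∀ {n} .{{_ : NonTrivial n}} (G H : Graph n) → ¬ (G ≅ H) → b G H ≤ B n
b≤B {n} G H G≇H = proj₂ (B-isMaximum n) (b G H) (G , H , G≇H , refl)

module _ {ε : ℚ} (0<ε : 0ℚ < ε) where

  Close : ℕ → Set
  Close n = ∃₂ λ (G H : Graph n) → Connected G × Connected H × ¬ (G ≅ H) ×
    SameDegreeSequence G H × ((1ℚ - ε) * (+ n / 1) < + (b G H) / 1)

  close : InfinitelyMany Close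
  close N = order , N<order , G , H , G-connected , H-connected , noniso , sameDegreeSequence ,
    -- `good` is only a lower bound for `b G H`, obtained from its maximality; `d` was taken to be
    -- the denominator of `ε`.
    1-ε-bound 0<ε good rest (b G H) (proj₂ (b-isMaximum G H) good commonCards) rest-small
    where
    open Family (ℚ.↧ₙ ε) N
    open Graphs enc

  B-ratio-upper : ∀ k → + (B (2+ k)) / (2+ k) < 1ℚ ℚ.+ ε
  B-ratio-upper k = ℚ.≤-<-trans (ratio≤1 (B (2+ k)) (2+ k) (B≤n (2+ k)))
    (subst (_< 1ℚ ℚ.+ ε) (ℚ.+-identityʳ 1ℚ) (ℚ.+-monoʳ-< 1ℚ 0<ε))

  B-ratio-lower : ∀ k → Close (2+ k) → 1ℚ - ε < + (B (2+ k)) / (2+ k)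
  B-ratio-lower k (G , H , _ , _ , G≇H , _ , large) = <-ratio (B (2+ k)) (2+ k)
    (ℚ.<-≤-trans large (/1-mono-≤ {b G H} {B (2+ k)} (b≤B G H G≇H)))

  B-ratio-often-close : InfinitelyMany λ k → 1ℚ - ε < + (B (2+ k)) / (2+ k)
  -- Index `k` stands for order `2+ k`, so an order above `2+ N` yields an index above `N`.
  B-ratio-often-close N = shift (close (2+ N))
    where
    shift : (∃ λ n → 2+ N ℕ.< n × Close n) → ∃ λ k → N ℕ.< k × 1ℚ - ε < + (B (2+ k)) / (2+ k)
    shift (2+ k , s≤s (s≤s N<k) , close-k) = k , N<k , B-ratio-lower k close-k

corollary3p4 : (∀ (ε : ℚ) → 0ℚ < ε →
    InfinitelyMany λ n →
    ∃₂ λ (G H : Graph n) →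
    Connected G × Connected H × ¬ (G ≅ H) ×
    SameDegreeSequence G H ×
    ((1ℚ - ε) * (+ n / 1) < + (b G H) / 1))
    ×
    IsLimsup (λ k → + (B (2+ k)) / (2+ k)) 1ℚ
corollary3p4 = (λ ε → close) , λ ε 0<ε → (0 , λ k _ → B-ratio-upper 0<ε k) , B-ratio-often-close 0<ε
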